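{- Let $m$, $n$ and $k$ be integers (with $m,n\geq 1$) such that $m \leq n$ and $\gamma(K_{m,n}) < k < m+n$. Then $\mathcal{D}_k(K_{m,n})$ is Eulerian if and only if one of the following holds: (i) $m=1$, $n$ is even, and $k$ is odd; or (ii) $m \geq 3$, $m \equiv n \pmod 2$, and $k=3$.
   Context: All graphs are finite and simple. $K_{m,n}$ is the complete bipartite graph with partite sets of sizes $m$ and $n$. A dominating set of a graph $G$ is a set $D \subseteq V(G)$ such that every vertex of $V(G)\setminus D$ is adjacent to a vertex of $D$; the domination number $\gamma(G)$ is the cardinality of a smallest dominating set of $G$. The $k$-dominating graph $\mathcal{D}_k(G)$ is the graph whose vertices are the dominating sets of $G$ of cardinality at most $k$, two of them being adjacent if and only if one can be obtained from the other by adding or removing a single vertex of $G$. A graph is Eulerian if and only if every vertex has even degree and it contains at most one non-trivial component (a graph or component is trivial if it contains no edges); in particular, an Eulerian graph may have isolated vertices. -}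

module Defs where

import Data.Bool.Properties as Bool
open import Data.Empty using (⊥)
open import Data.Fin using (Fin; zero; suc)
open import Data.Fin.Properties using (+↔⊎; any?; all?)
open import Data.Fin.Subset as Subset using (Subset; inside; outside; _∈_; _∉_; ⁅_⁆; _∪_; _-_; ∣_∣)
open import Data.Fin.Subset.Properties using (_∈?_; ∈⊤; x∈p∪q⁺; x∈⁅x⁆; ∪-identityʳ; p─⊥≡p)
open import Data.Irrelevant using ([_])
open import Data.List using (List; []; _∷_; _++_; map; filter; length; lookup; allFin)
open import Data.List.Extrema.Nat using (argmin; argmin-all; f[argmin]≤f[xs])
open import Data.List.Membership.Propositional using () renaming (_∈_ to _∈ˡ_)
open import Data.List.Membership.Propositional.Properties using (∈-lookup; ∈-++⁺ˡ; ∈-++⁺ʳ; ∈-map⁺; ∈-map⁻; ∈-filter⁺)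
import Data.List.Relation.Unary.All as All
import Data.List.Relation.Unary.All.Properties as All
open import Data.List.Relation.Unary.AllPairs using ([]; _∷_)
open import Data.List.Relation.Unary.Any using (here; there; index)
open import Data.List.Relation.Unary.Any.Properties using (lookup-index)
open import Data.List.Relation.Unary.Unique.Propositional using (Unique)
import Data.List.Relation.Unary.Unique.Propositional.Properties as Unique
open import Data.Nat using (ℕ; zero; suc; _+_; _≤_; _≤?_)
open import Data.Nat.Divisibility using (_∣_)
open import Data.Product using (∃; _×_; _,_)
open import Data.Refinement using (Refinement-syntax; _,_; value)
open import Data.Sum using (_⊎_; inj₁; inj₂)
open import Data.Unit using (⊤)
open import Data.Vec using ([]; _∷_)
import Data.Vec as Vec
open import Data.Vec.Properties using (≡-dec; ∷-injectiveʳ)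
open import Function using (Inverse; _↔_; mk↔ₛ′)
open import Function.Properties.Inverse using (↔-sym)
open import Level using (0ℓ)
open import Relation.Binary using (Rel; Symmetric; Irreflexive)
import Relation.Binary as Binary
open import Relation.Binary.Construct.Closure.ReflexiveTransitive using (Star)
open import Relation.Binary.PropositionalEquality using (_≡_; refl; sym; trans; cong; subst)
open import Relation.Nullary using (¬_; Dec; yes; no; contradiction; contradiction-irr)
open import Relation.Nullary.Decidable using (map′; _×-dec_; _⊎-dec_; _→-dec_; ¬?)
open import Relation.Unary using (Pred; Decidable; _≐_)

private
  variable
    n : ℕ
    A : Set

------------------------------------------------------------------------
-- Finite simple graphs

record Graph : Set₁ where
  infix 4 _~_ _~?_
  field
    Vertex      : Set
    order       : ℕ
    enumeration : Vertex ↔ Fin order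
    _~_         : Rel Vertex 0ℓ
    _~?_        : Binary.Decidable _~_
    ~-sym       : Symmetric _~_
    ~-irrefl    : Irreflexive _≡_ _~_

  open Inverse enumeration public
    using ()
    renaming (to to toIndex; from to vertex; strictlyInverseˡ to toIndex-vertex; strictlyInverseʳ to vertex-toIndex)

  vertices : List Vertex
  vertices = map vertex (allFin order)

  degree : Vertex → ℕ
  degree v = length (filter (v ~?_) vertices)

  component : Vertex → Pred Vertex 0ℓ
  component v w = Star _~_ v w

  NonTrivial : Pred (Pred Vertex 0ℓ) 0ℓ
  NonTrivial C = ∃ λ x → ∃ λ y → C x × C y × x ~ y

  AtMostOneNonTrivialComponent : Set
  AtMostOneNonTrivialComponent = ∀ u v →
    NonTrivial (component u) → NonTrivial (component v) → component u ≐ component v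

  Eulerian : Set
  Eulerian = (∀ v → 2 ∣ degree v) × AtMostOneNonTrivialComponent

  all-vertices? : {P : Pred Vertex 0ℓ} → Decidable P → Dec (∀ v → P v)
  all-vertices? {P} P? = map′
    (λ h v → subst P (vertex-toIndex v) (h (toIndex v)))
    (λ h i → h (vertex i))
    (all? (λ i → P? (vertex i)))

  any-vertex? : {P : Pred Vertex 0ℓ} → Decidable P → Dec (∃ P)
  any-vertex? {P} P? = map′
    (λ (i , p) → vertex i , p)
    (λ (v , p) → toIndex v , subst P (sym (vertex-toIndex v)) p)
    (any? (λ i → P? (vertex i)))

  -- A set of vertices is given by the subset of their indices.

  Dominating : Pred (Subset order) 0ℓ
  Dominating D = ∀ v → toIndex v ∉ D → ∃ λ u → toIndex u ∈ D × v ~ u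

  dominating? : Decidable Dominating
  dominating? D = all-vertices? λ v →
    ¬? (toIndex v ∈? D) →-dec any-vertex? λ u → (toIndex u ∈? D) ×-dec (v ~? u)

  ⊤-dominating : Dominating Subset.⊤
  ⊤-dominating v v∉⊤ = contradiction ∈⊤ v∉⊤

open Graph public using (Eulerian)

------------------------------------------------------------------------
-- Complete bipartite graphs

K : ℕ → ℕ → Graph
K m n = record
  { Vertex      = Fin m ⊎ Fin n
  ; order       = m + n
  ; enumeration = ↔-sym +↔⊎
  ; _~_         = Adjacent
  ; _~?_        = adjacent?
  ; ~-sym       = λ {u} {v} → adjacent-sym u v
  ; ~-irrefl    = λ { {u} refl → adjacent-irrefl u }
  }
  where
  Adjacent : Rel (Fin m ⊎ Fin n) 0ℓ
  Adjacent (inj₁ _) (inj₁ _) = ⊥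
  Adjacent (inj₁ _) (inj₂ _) = ⊤
  Adjacent (inj₂ _) (inj₁ _) = ⊤
  Adjacent (inj₂ _) (inj₂ _) = ⊥

  adjacent? : Binary.Decidable Adjacent
  adjacent? (inj₁ _) (inj₁ _) = no λ ()
  adjacent? (inj₁ _) (inj₂ _) = yes _
  adjacent? (inj₂ _) (inj₁ _) = yes _
  adjacent? (inj₂ _) (inj₂ _) = no λ ()

  adjacent-sym : ∀ u v → Adjacent u v → Adjacent v u
  adjacent-sym (inj₁ _) (inj₂ _) _ = _
  adjacent-sym (inj₂ _) (inj₁ _) _ = _

  adjacent-irrefl : ∀ u → ¬ Adjacent u u
  adjacent-irrefl (inj₁ _) ()
  adjacent-irrefl (inj₂ _) ()

------------------------------------------------------------------------
-- Enumerations of finite types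

subsets : ∀ n → List (Subset n)
subsets zero    = [] ∷ []
subsets (suc n) = map (outside ∷_) (subsets n) ++ map (inside ∷_) (subsets n)

∈-subsets : (D : Subset n) → D ∈ˡ subsets n
∈-subsets []            = here refl
∈-subsets (outside ∷ D) = ∈-++⁺ˡ (∈-map⁺ _ (∈-subsets D))
∈-subsets (inside  ∷ D) = ∈-++⁺ʳ _ (∈-map⁺ _ (∈-subsets D))

subsets-unique : ∀ n → Unique (subsets n)
subsets-unique zero    = All.[] ∷ []
subsets-unique (suc n) = Unique.++⁺
  (Unique.map⁺ ∷-injectiveʳ (subsets-unique n))
  (Unique.map⁺ ∷-injectiveʳ (subsets-unique n))
  λ (D∈out , D∈in) → disjoint D∈out D∈in
  where
  disjoint : ∀ {D} → D ∈ˡ map (outside ∷_) (subsets n) → ¬ D ∈ˡ map (inside ∷_) (subsets n)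
  disjoint D∈out D∈in with ∈-map⁻ (outside ∷_) D∈out | ∈-map⁻ (inside ∷_) D∈in
  ... | _ , _ , refl | _ , _ , ()

lookup-injective : {xs : List A} → Unique xs → ∀ i j → lookup xs i ≡ lookup xs j → i ≡ j
lookup-injective (_    ∷ _)   zero    zero    _  = refl
lookup-injective (x∉xs ∷ _)   zero    (suc j) eq = contradiction eq (All.lookup x∉xs (∈-lookup j))
lookup-injective (x∉xs ∷ _)   (suc i) zero    eq = contradiction (sym eq) (All.lookup x∉xs (∈-lookup i))
lookup-injective (_    ∷ xs!) (suc i) (suc j) eq = cong suc (lookup-injective xs! i j eq)

enumerate : (xs : List A) → Unique xs → (∀ a → a ∈ˡ xs) → A ↔ Fin (length xs)
enumerate xs xs! complete = mk↔ₛ′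
  (λ a → index (complete a))
  (lookup xs)
  (λ i → lookup-injective xs! _ i (sym (lookup-index (complete (lookup xs i)))))
  (λ a → sym (lookup-index (complete a)))

module _ {P : Pred A 0ℓ} (P? : Decidable P) where

  refineFilter : List A → List [ a ∈ A ∣ P a ]
  refineFilter []       = []
  refineFilter (x ∷ xs) with P? x
  ... | yes p = (x , [ p ]) ∷ refineFilter xs
  ... | no  _ = refineFilter xs

  map-value-refineFilter : ∀ xs → map value (refineFilter xs) ≡ filter P? xs
  map-value-refineFilter []       = refl
  map-value-refineFilter (x ∷ xs) with P? x
  ... | yes _ = cong (x ∷_) (map-value-refineFilter xs)
  ... | no  _ = map-value-refineFilter xs

  refineFilter-unique : ∀ {xs} → Unique xs → Unique (refineFilter xs)
  refineFilter-unique {xs} xs! = Unique.map⁻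
    (subst Unique (sym (map-value-refineFilter xs)) (Unique.filter⁺ P? xs!))

  ∈-refineFilter : ∀ {xs} (a : [ a ∈ A ∣ P a ]) → value a ∈ˡ xs → a ∈ˡ refineFilter xs
  ∈-refineFilter {x ∷ xs} (_ , [ p ]) a∈ with P? x | a∈
  ... | yes _  | here refl  = here refl
  ... | no  ¬p | here refl  = contradiction-irr p ¬p
  ... | yes _  | there a∈xs = there (∈-refineFilter _ a∈xs)
  ... | no  _  | there a∈xs = ∈-refineFilter _ a∈xs

------------------------------------------------------------------------
-- The domination number

module _ (G : Graph) where
  open Graph G

  -- The default value of argmin, the full subset, is itself dominating.
  minimumDominatingSet : Subset order
  minimumDominatingSet = argmin ∣_∣ Subset.⊤ (filter dominating? (subsets order))

  γ : ℕ
  γ = ∣ minimumDominatingSet ∣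

  minimumDominatingSet-dominating : Dominating minimumDominatingSet
  minimumDominatingSet-dominating =
    argmin-all ∣_∣ ⊤-dominating (All.all-filter dominating? (subsets order))

  γ-minimum : ∀ {D} → Dominating D → γ ≤ ∣ D ∣
  γ-minimum {D} dom = All.lookup
    (f[argmin]≤f[xs] Subset.⊤ (filter dominating? (subsets order)))
    (∈-filter⁺ dominating? (∈-subsets D) dom)

------------------------------------------------------------------------
-- Dominating graphs

-- E is obtained from D by adding or removing a single element.
_⟶_ : Rel (Subset n) 0ℓ
D ⟶ E = ∃ λ x → (x ∉ D × E ≡ D ∪ ⁅ x ⁆) ⊎ (x ∈ D × E ≡ D - x)

_⟶?_ : Binary.Decidable (_⟶_ {n})
D ⟶? E = any? λ x →
  (¬? (x ∈? D) ×-dec (E ≟ (D ∪ ⁅ x ⁆))) ⊎-dec ((x ∈? D) ×-dec (E ≟ (D - x)))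
  where _≟_ = ≡-dec Bool._≟_

x∈p∪⁅x⁆ : ∀ x (D : Subset n) → x ∈ D ∪ ⁅ x ⁆
x∈p∪⁅x⁆ x D = x∈p∪q⁺ {p = D} (inj₂ (x∈⁅x⁆ x))

x∉p-x : ∀ x (D : Subset n) → x ∉ D - x
x∉p-x zero    (_ ∷ _) ()
x∉p-x (suc x) (_ ∷ D) (Vec.there x∈) = x∉p-x x D x∈

add-remove : ∀ x (D : Subset n) → x ∉ D → D ≡ (D ∪ ⁅ x ⁆) - x
add-remove zero    (outside ∷ D) _   = cong (outside ∷_)
  (sym (trans (p─⊥≡p _) (∪-identityʳ D)))
add-remove zero    (inside  ∷ D) x∉D = contradiction Vec.here x∉D
add-remove (suc x) (outside ∷ D) x∉D = cong (outside ∷_) (add-remove x D (λ x∈D → x∉D (Vec.there x∈D)))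
add-remove (suc x) (inside  ∷ D) x∉D = cong (inside ∷_) (add-remove x D (λ x∈D → x∉D (Vec.there x∈D)))

remove-add : ∀ x (D : Subset n) → x ∈ D → D ≡ (D - x) ∪ ⁅ x ⁆
remove-add zero    (inside  ∷ D) _               = cong (inside ∷_)
  (sym (trans (∪-identityʳ _) (p─⊥≡p D)))
remove-add (suc x) (outside ∷ D) (Vec.there x∈D) = cong (outside ∷_) (remove-add x D x∈D)
remove-add (suc x) (inside  ∷ D) (Vec.there x∈D) = cong (inside ∷_) (remove-add x D x∈D)

⟶-sym : Symmetric (_⟶_ {n})
⟶-sym {x = D} (x , inj₁ (x∉D , refl)) = x , inj₂ (x∈p∪⁅x⁆ x D , add-remove x D x∉D)
⟶-sym {x = D} (x , inj₂ (x∈D , refl)) = x , inj₁ (x∉p-x x D , remove-add x D x∈D)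

⟶-irrefl : Irreflexive _≡_ (_⟶_ {n})
⟶-irrefl {x = D} refl (x , inj₁ (x∉D , eq)) = x∉D (subst (x ∈_) (sym eq) (x∈p∪⁅x⁆ x D))
⟶-irrefl {x = D} refl (x , inj₂ (x∈D , eq)) = x∉p-x x D (subst (x ∈_) eq x∈D)

module _ (k : ℕ) (G : Graph) where
  open Graph G using (order; Dominating; dominating?)

  SmallDominating : Pred (Subset order) 0ℓ
  SmallDominating D = Dominating D × ∣ D ∣ ≤ k

  smallDominating? : Decidable SmallDominating
  smallDominating? D = dominating? D ×-dec (∣ D ∣ ≤? k)

  𝒟 : Graph
  𝒟 = record
    { Vertex      = [ D ∈ Subset order ∣ SmallDominating D ]
    ; order       = length (refineFilter smallDominating? (subsets order))
    ; enumeration = enumerate (refineFilter smallDominating? (subsets order))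
                      (refineFilter-unique smallDominating? (subsets-unique order))
                      (λ D → ∈-refineFilter smallDominating? D (∈-subsets (value D)))
    ; _~_         = λ D E → value D ⟶ value E
    ; _~?_        = λ D E → value D ⟶? value E
    ; ~-sym       = ⟶-sym
    ; ~-irrefl    = λ { refl → ⟶-irrefl refl }
    }

{-# OPTIONS --safe #-}

-- A set with a vertices in the part of size m and b in the part of size n
-- dominates K m n exactly when (a ≥ 1 or b = n) and (b ≥ 1 or a = m).  Hence the
-- degree of a vertex of 𝒟 k (K m n) depends only on (a , b):
--   * m = 1: the sets containing the centre have degree n, or k − 1 when they
--     have k elements;
--   * m ≥ 2: (1 , 1) has degree m + n − 2, and (1 , 2) has degree m + n − 1 as
--     soon as k ≥ 4, so k = 3 and m ≡ n (mod 2); for m = 2, (2 , 1) has degree 3.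
-- Conversely, the sets meeting only one part are isolated, and all the others
-- are joined to a fixed one by passing to supersets and subsets.
module Submission where

open import Defs
open import Data.Bool using (not; if_then_else_)
open import Data.Fin using (Fin; zero; suc; _↑ˡ_; _↑ʳ_)
open import Data.Fin.Subset as Subset using (Subset; Nonempty; inside; outside; _∈_; _∉_; _⊆_; ⁅_⁆; _∪_; _-_; ∣_∣; ∁)
open import Data.Fin.Subset.Properties
open import Data.Irrelevant using ([_])
open import Data.List using (List; []; _∷_; map; filter; length)
import Data.List as List
open import Data.List.Membership.Propositional using () renaming (_∈_ to _∈ˡ_)
open import Data.List.Membership.Propositional.Properties using (∈-map⁺; ∈-map⁻; ∈-filter⁺; ∈-filter⁻; ∈-allFin)
open import Data.List.Membership.Propositional.Properties.WithK using (unique∧set⇒bag)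
open import Data.List.Properties using (length-map; length-++; filter-++; filter-≐; map-++; map-∘; map-id)
open import Data.List.Relation.Binary.BagAndSetEquality using (∼bag⇒↭)
open import Data.List.Relation.Binary.Permutation.Propositional.Properties using (↭-length)
import Data.List.Relation.Unary.All as All
import Data.List.Relation.Unary.All.Properties as All
open import Data.List.Relation.Unary.AllPairs using ([]; _∷_)
open import Data.List.Relation.Unary.Any using (here; there)
open import Data.List.Relation.Unary.Unique.Propositional using (Unique)
import Data.List.Relation.Unary.Unique.Propositional.Properties as Unique
open import Data.Nat using (ℕ; zero; suc; pred; _+_; _∸_; _≤_; _<_; z≤n; s≤s; s≤s⁻¹; _≤?_; _%_) renaming (_≟_ to _≟ℕ_)
open import Data.Nat.Properties
open import Data.Nat.Divisibility using (_∣_; _∣0; ∣-refl; ∣m+n∣m⇒∣n; ∣m∣n⇒∣m+n; n∣m⇒m%n≡0; m%n≡0⇒n∣m; ∣1⇒≡1)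
open import Data.Product using (∃; _×_; _,_; proj₁; proj₂)
open import Data.Refinement using (_,_; value)
open import Data.Sum using (_⊎_; inj₁; inj₂)
open import Data.Vec using ([]; _∷_; _++_; take; drop; here; there)
open import Data.Vec.Properties using (∷-injectiveʳ; []=⇒lookup; lookup⇒[]=; lookup-++ˡ; lookup-++ʳ; take++drop≡id)
open import Function using (_⇔_; mk⇔; Equivalence; _∘_; id)
open import Level using (0ℓ)
open import Relation.Binary.Construct.Closure.ReflexiveTransitive using (Star; ε; _◅_; _◅◅_; gmap; reverse)
open import Relation.Binary.PropositionalEquality using (_≡_; _≢_; refl; sym; trans; cong; cong₂; subst; subst₂; module ≡-Reasoning)
open import Relation.Nullary using (¬_; Dec; yes; no; does; contradiction; recompute)
open import Relation.Nullary.Decidable using (_×-dec_; _⊎-dec_)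
open import Relation.Unary using (Pred; Decidable)

private
  variable
    m n a b c : ℕ
    S T : Set

-- List lengths and conditional counts

length-filter-map : {P : Pred T 0ℓ} (P? : Decidable P) (f : S → T) (xs : List S) →
  length (filter P? (map f xs)) ≡ length (filter (P? ∘ f) xs)
length-filter-map P? f []       = refl
length-filter-map P? f (x ∷ xs) with P? (f x)
... | yes _ = cong suc (length-filter-map P? f xs)
... | no  _ = length-filter-map P? f xs

-- Membership proofs in duplicate-free lists are unique, so equal membership is already bag
-- equality, and the lists are permutations of each other.
same-elements⇒same-length : {xs ys : List S} → Unique xs → Unique ys →
  (∀ {x} → x ∈ˡ xs ⇔ x ∈ˡ ys) → length xs ≡ length ys
same-elements⇒same-length xs! ys! xs⇔ys = ↭-length (∼bag⇒↭ (unique∧set⇒bag xs! ys! xs⇔ys))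

infix 8 _when_

-- Neighbours of a set that arise by the same kind of change have the same sizes, so they enter a
-- degree all together or not at all.
_when_ : ℕ → {P : Set} → Dec P → ℕ
x when P? = if does P? then x else 0

when-yes : ∀ {x} {P : Set} (P? : Dec P) → P → x when P? ≡ x
when-yes (yes _) _ = refl
when-yes (no ¬p) p = contradiction p ¬p

when-no : ∀ {x} {P : Set} (P? : Dec P) → ¬ P → x when P? ≡ 0
when-no (yes p) ¬p = contradiction p ¬p
when-no (no _)  _  = refl

0-when : {P : Set} (P? : Dec P) → 0 when P? ≡ 0
0-when (yes _) = refl
0-when (no _)  = refl

-- At `x = 0` the two arguments of `Q?` differ, but there both sides count nothing.
when-suc-pred : {Q : Pred ℕ 0ℓ} (Q? : Decidable Q) (x : ℕ) → x when Q? (suc (pred x)) ≡ x when Q? x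
when-suc-pred Q? zero    = trans (0-when (Q? 1)) (sym (0-when (Q? 0)))
when-suc-pred Q? (suc x) = refl

-- The neighbours of a set in the hypercube of all subsets.
flips : Subset n → List (Subset n)
flips []      = []
flips (s ∷ D) = (not s ∷ D) ∷ map (s ∷_) (flips D)

flips-unique : (D : Subset n) → Unique (flips D)
flips-unique []      = []
flips-unique (s ∷ D) = All.map⁺ (All.universal (λ _ → s≢ s) (flips D)) ∷ Unique.map⁺ ∷-injectiveʳ (flips-unique D)
  where
  s≢ : ∀ s {D E : Subset _} → not s ∷ D ≢ s ∷ E
  s≢ inside  ()
  s≢ outside ()

⟶-∷ : ∀ s {D E : Subset n} → D ⟶ E → (s ∷ D) ⟶ (s ∷ E)
⟶-∷ inside  (x , inj₁ (x∉D , refl)) = suc x , inj₁ ((λ { (there x∈D) → x∉D x∈D }) , refl)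
⟶-∷ outside (x , inj₁ (x∉D , refl)) = suc x , inj₁ ((λ { (there x∈D) → x∉D x∈D }) , refl)
⟶-∷ inside  (x , inj₂ (x∈D , refl)) = suc x , inj₂ (there x∈D , refl)
⟶-∷ outside (x , inj₂ (x∈D , refl)) = suc x , inj₂ (there x∈D , refl)

⟶-head : ∀ s (D : Subset n) → (s ∷ D) ⟶ (not s ∷ D)
⟶-head inside  D = zero , inj₂ (here , cong (outside ∷_) (sym (p─⊥≡p D)))
⟶-head outside D = zero , inj₁ ((λ ()) , cong (inside ∷_) (sym (∪-identityʳ D)))

∈-flips⁻ : {D E : Subset n} → E ∈ˡ flips D → D ⟶ E
∈-flips⁻ {D = s ∷ D} (here refl) = ⟶-head s D
∈-flips⁻ {D = s ∷ D} (there E∈)  with ∈-map⁻ (s ∷_) E∈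
... | _ , E′∈ , refl = ⟶-∷ s (∈-flips⁻ E′∈)

∈-flips⁺ : {D E : Subset n} → D ⟶ E → E ∈ˡ flips D
∈-flips⁺ {D = D} (x , inj₁ (x∉D , refl)) = added x D x∉D
  where
  added : ∀ {n} (x : Fin n) D → x ∉ D → (D ∪ ⁅ x ⁆) ∈ˡ flips D
  added zero    (inside  ∷ D) x∉D = contradiction here x∉D
  added zero    (outside ∷ D) x∉D = here (cong (inside ∷_) (∪-identityʳ D))
  added (suc x) (inside  ∷ D) x∉D = there (∈-map⁺ _ (added x D (x∉D ∘ there)))
  added (suc x) (outside ∷ D) x∉D = there (∈-map⁺ _ (added x D (x∉D ∘ there)))
∈-flips⁺ {D = D} (x , inj₂ (x∈D , refl)) = removed x D x∈D
  where
  removed : ∀ {n} (x : Fin n) D → x ∈ D → (D - x) ∈ˡ flips D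
  removed zero    (inside  ∷ D) _           = here (cong (outside ∷_) (p─⊥≡p D))
  removed (suc x) (inside  ∷ D) (there x∈D) = there (∈-map⁺ _ (removed x D x∈D))
  removed (suc x) (outside ∷ D) (there x∈D) = there (∈-map⁺ _ (removed x D x∈D))

-- A flip changes a single position, which lies in exactly one of the two parts.
flips-++ : (A : Subset m) (B : Subset n) →
  flips (A ++ B) ≡ map (_++ B) (flips A) List.++ map (A ++_) (flips B)
flips-++ []      B = sym (map-id (flips B))
flips-++ (s ∷ A) B = cong ((not s ∷ A ++ B) ∷_) (begin
  map (s ∷_) (flips (A ++ B))
    ≡⟨ cong (map (s ∷_)) (flips-++ A B) ⟩
  map (s ∷_) (map (_++ B) (flips A) List.++ map (A ++_) (flips B))
    ≡⟨ map-++ (s ∷_) (map (_++ B) (flips A)) _ ⟩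
  map (s ∷_) (map (_++ B) (flips A)) List.++ map (s ∷_) (map (A ++_) (flips B))
    -- The two composed maps agree definitionally, as `(s ∷ A) ++ B` reduces to `s ∷ (A ++ B)`.
    ≡⟨ cong₂ List._++_ (trans (sym (map-∘ (flips A))) (map-∘ (flips A))) (sym (map-∘ (flips B))) ⟩
  map (_++ B) (map (s ∷_) (flips A)) List.++ map ((s ∷ A) ++_) (flips B) ∎)
  where open ≡-Reasoning

-- There are `∣ D ∣` removals and `∣ ∁ D ∣` additions, and each kind leads to a single size. For
-- empty `D` the truncated `pred` does no harm, since its weight is 0.
count-flips : {Q : Pred ℕ 0ℓ} (Q? : Decidable Q) (D : Subset n) →
  length (filter (Q? ∘ ∣_∣) (flips D)) ≡ ∣ D ∣ when Q? (pred ∣ D ∣) + ∣ ∁ D ∣ when Q? (suc ∣ D ∣)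
count-flips Q? [] = sym (cong₂ _+_ (0-when (Q? 0)) (0-when (Q? 1)))
count-flips Q? (outside ∷ D)
  with ih ← trans (length-filter-map (Q? ∘ ∣_∣) (outside ∷_) (flips D)) (count-flips Q? D) | Q? (suc ∣ D ∣)
... | yes _ = trans (cong suc ih) (sym (+-suc _ _))
... | no  _ = ih
-- The head adds one to the size of every flip of the tail, so the induction runs on `Q? ∘ suc`.
count-flips Q? (inside ∷ D)
  with ih ← trans (length-filter-map (Q? ∘ ∣_∣) (inside ∷_) (flips D))
              (trans (count-flips (Q? ∘ suc) D) (cong (_+ ∣ ∁ D ∣ when Q? (2 + ∣ D ∣)) (when-suc-pred Q? ∣ D ∣)))
     | Q? ∣ D ∣
... | yes _ = cong suc ih
... | no  _ = ih

-- Subsets of a sum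

∣++∣ : (A : Subset m) (B : Subset n) → ∣ A ++ B ∣ ≡ ∣ A ∣ + ∣ B ∣
∣++∣ []            B = refl
∣++∣ (inside  ∷ A) B = cong suc (∣++∣ A B)
∣++∣ (outside ∷ A) B = ∣++∣ A B

∣∪∣≤ : (A B : Subset n) → ∣ A ∪ B ∣ ≤ ∣ A ∣ + ∣ B ∣
∣∪∣≤ []            []            = z≤n
∣∪∣≤ (outside ∷ A) (outside ∷ B) = ∣∪∣≤ A B
∣∪∣≤ (outside ∷ A) (inside  ∷ B) = ≤-trans (s≤s (∣∪∣≤ A B)) (≤-reflexive (sym (+-suc _ _)))
∣∪∣≤ (inside  ∷ A) (outside ∷ B) = s≤s (∣∪∣≤ A B)
∣∪∣≤ (inside  ∷ A) (inside  ∷ B) = s≤s (≤-trans (∣∪∣≤ A B) (+-monoʳ-≤ ∣ A ∣ (n≤1+n ∣ B ∣)))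

∈-++ˡ : {A : Subset m} {B : Subset n} {i : Fin m} → i ∈ A ⇔ i ↑ˡ n ∈ A ++ B
∈-++ˡ {A = A} {B} {i} = mk⇔
  (λ i∈A → lookup⇒[]= _ _ (trans (lookup-++ˡ A B i) ([]=⇒lookup i∈A)))
  (λ i∈AB → lookup⇒[]= _ _ (trans (sym (lookup-++ˡ A B i)) ([]=⇒lookup i∈AB)))

∈-++ʳ : {A : Subset m} {B : Subset n} {j : Fin n} → j ∈ B ⇔ m ↑ʳ j ∈ A ++ B
∈-++ʳ {A = A} {B} {j} = mk⇔
  (λ j∈B → lookup⇒[]= _ _ (trans (lookup-++ʳ A B j) ([]=⇒lookup j∈B)))
  (λ j∈AB → lookup⇒[]= _ _ (trans (sym (lookup-++ʳ A B j)) ([]=⇒lookup j∈AB)))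

++-mono-⊆ : {A A′ : Subset m} {B B′ : Subset n} → A ⊆ A′ → B ⊆ B′ → A ++ B ⊆ A′ ++ B′
++-mono-⊆ {A = []}    {[]}    _    B⊆B′ x∈          = B⊆B′ x∈
++-mono-⊆ {A = _ ∷ _} {_ ∷ _} A⊆A′ B⊆B′ here with here ← A⊆A′ here = here
++-mono-⊆ {A = _ ∷ _} {_ ∷ _} A⊆A′ B⊆B′ (there x∈)  = there (++-mono-⊆ (drop-∷-⊆ A⊆A′) B⊆B′ x∈)

∃-size : a ≤ n → ∃ λ (A : Subset n) → ∣ A ∣ ≡ a
∃-size {n = n} z≤n = Subset.⊥ , ∣⊥∣≡0 n
∃-size (s≤s a≤n) with ∃-size a≤n
... | A , eq = inside ∷ A , cong suc eq

nonempty⇒0<∣∣ : {A : Subset n} → Nonempty A → 1 ≤ ∣ A ∣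
nonempty⇒0<∣∣ (zero  , here)      = s≤s z≤n
nonempty⇒0<∣∣ {A = s ∷ A} (suc x , there x∈A) = ≤-trans (nonempty⇒0<∣∣ (x , x∈A)) (∣p∣≤∣x∷p∣ s A)

0<∣∣⇒nonempty : (A : Subset n) → 1 ≤ ∣ A ∣ → Nonempty A
0<∣∣⇒nonempty (inside  ∷ A) _ = zero , here
0<∣∣⇒nonempty (outside ∷ A) 1≤ with 0<∣∣⇒nonempty A 1≤
... | x , x∈A = suc x , there x∈A

full⇒∣∣≡n : {A : Subset n} → (∀ x → x ∈ A) → ∣ A ∣ ≡ n
full⇒∣∣≡n {n} {A} full = ≤-antisym (∣p∣≤n A)
  (subst (_≤ ∣ A ∣) (∣⊤∣≡n n) (p⊆q⇒∣p∣≤∣q∣ {p = Subset.⊤} (λ _ → full _)))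

empty⇒∣∣≡0 : {A : Subset n} → ¬ Nonempty A → ∣ A ∣ ≡ 0
empty⇒∣∣≡0 {n} A≡∅ = trans (cong ∣_∣ (Empty-unique A≡∅)) (∣⊥∣≡0 n)

-- Deleting the elements of `D` outside `E` one at a time passes only through sets between `E` and
-- `D`, so `P` is required only of those.
descend : {P : Pred (Subset n) 0ℓ} {D E : Subset n} → E ⊆ D → (∀ X → E ⊆ X → X ⊆ D → P X) →
  Star (λ X Y → X ⟶ Y × P Y) D E
descend {D = []}          {[]}          _   _ = ε
descend {D = inside ∷ D}  {outside ∷ E} E⊆D P[] =
  gmap (inside ∷_) (λ (X⟶Y , PY) → ⟶-∷ inside X⟶Y , PY)
    (descend (drop-∷-⊆ E⊆D) (λ X E⊆X X⊆D → P[] (inside ∷ X) (out⊆ E⊆X) (s⊆s X⊆D)))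
  -- The head goes last, once the tail has shrunk to `E`.
  ◅◅ (⟶-head inside E , P[] _ id E⊆D) ◅ ε
descend {D = outside ∷ D} {inside ∷ E}  E⊆D _ with () ← E⊆D here
descend {D = inside ∷ D}  {inside ∷ E}  E⊆D P[] =
  gmap (inside ∷_) (λ (X⟶Y , PY) → ⟶-∷ inside X⟶Y , PY)
    (descend (drop-∷-⊆ E⊆D) (λ X E⊆X X⊆D → P[] (inside ∷ X) (s⊆s E⊆X) (s⊆s X⊆D)))
descend {D = outside ∷ D} {outside ∷ E} E⊆D P[] =
  gmap (outside ∷_) (λ (X⟶Y , PY) → ⟶-∷ outside X⟶Y , PY)
    (descend (drop-∷-⊆ E⊆D) (λ X E⊆X X⊆D → P[] (outside ∷ X) (s⊆s E⊆X) (s⊆s X⊆D)))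

-- Degrees and connectivity in dominating graphs

module _ (G : Graph) where
  open Graph G

  vertices-unique : Unique vertices
  vertices-unique = Unique.map⁺ injective (Unique.allFin⁺ order)
    where
    injective : ∀ {i j} → vertex i ≡ vertex j → i ≡ j
    injective eq = trans (sym (toIndex-vertex _)) (trans (cong toIndex eq) (toIndex-vertex _))

  ∈-vertices : ∀ v → v ∈ˡ vertices
  ∈-vertices v = subst (_∈ˡ vertices) (vertex-toIndex v) (∈-map⁺ vertex (∈-allFin (toIndex v)))

  degree≡length : ∀ {v} {ns : List Vertex} → Unique ns → (∀ {w} → w ∈ˡ ns ⇔ v ~ w) → degree v ≡ length ns
  degree≡length {v} ns! ns⇔ = same-elements⇒same-length (Unique.filter⁺ (v ~?_) vertices-unique) ns!
    (mk⇔ (λ w∈ → Equivalence.from ns⇔ (proj₂ (∈-filter⁻ (v ~?_) {xs = vertices} w∈)))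
         (λ w∈ → ∈-filter⁺ (v ~?_) (∈-vertices _) (Equivalence.to ns⇔ w∈)))

  degree≡0⇒isolated : ∀ v w → degree v ≡ 0 → ¬ v ~ w
  degree≡0⇒isolated v w eq v~w with filter (v ~?_) vertices | ∈-filter⁺ (v ~?_) (∈-vertices w) v~w
  ... | [] | ()

  -- A non-trivial component contains an edge, from which `r` is reached, so all such components
  -- contain `r`. Isolated vertices are exempt from reaching it.
  hub⇒atMostOneNonTrivialComponent : ∀ r → (∀ u w → u ~ w → Star _~_ u r) → AtMostOneNonTrivialComponent
  hub⇒atMostOneNonTrivialComponent r toHub u v Cu Cv =
    (λ u↝x → (v↝r ◅◅ reverse ~-sym u↝r) ◅◅ u↝x) , (λ v↝x → (u↝r ◅◅ reverse ~-sym v↝r) ◅◅ v↝x)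
    where
    nonTrivial↝hub : ∀ {u} → NonTrivial (component u) → Star _~_ u r
    nonTrivial↝hub (x , y , u↝x , _ , x~y) = u↝x ◅◅ toHub x y x~y
    u↝r = nonTrivial↝hub Cu
    v↝r = nonTrivial↝hub Cv

  dominating-⊆ : ∀ {D E} → D ⊆ E → Dominating D → Dominating E
  dominating-⊆ D⊆E dom v v∉E with dom v (v∉E ∘ D⊆E)
  ... | u , u∈D , v~u = u , D⊆E u∈D , v~u

module _ (k : ℕ) (G : Graph) where
  open Graph (𝒟 k G)

  -- This replaces the enumeration of all dominating sets by the short explicit list of flips.
  degree-𝒟 : ∀ v → degree v ≡ length (filter (smallDominating? k G) (flips (value v)))
  degree-𝒟 v = begin
    degree v                       ≡⟨ degree≡length (𝒟 k G) {v = v} (refineFilter-unique small? (flips-unique D)) (mk⇔ to from) ⟩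
    length neighbours              ≡⟨ length-map value neighbours ⟨
    length (map value neighbours)  ≡⟨ cong length (map-value-refineFilter small? (flips D)) ⟩
    length (filter small? (flips D)) ∎
    where
    open ≡-Reasoning
    D = value v
    small? = smallDominating? k G
    neighbours = refineFilter small? (flips D)
    to : ∀ {w} → w ∈ˡ neighbours → v ~ w
    to {w} w∈ = ∈-flips⁻ (proj₁ (∈-filter⁻ small? {xs = flips D}
      (subst (value w ∈ˡ_) (map-value-refineFilter small? (flips D)) (∈-map⁺ value w∈))))
    from : ∀ {w} → v ~ w → w ∈ˡ neighbours
    from {w} v~w = ∈-refineFilter small? w (∈-flips⁺ v~w)

  -- The proofs carried by vertices are irrelevant: the two ends may have any, and each intermediate
  -- set brings its own from the chain.
  lift : ∀ {D E} .p .q → Star (λ X Y → X ⟶ Y × SmallDominating k G Y) D E → Star _~_ (D , [ p ]) (E , [ q ])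
  lift p q ε                 = ε
  lift p q ((D⟶X , r) ◅ X↝E) = D⟶X ◅ lift r q X↝E

  -- A set between the two inherits domination from the smaller and the size bound from the larger.
  ⊇⇒connected : ∀ {v w} → value w ⊆ value v → Star _~_ v w
  ⊇⇒connected {D , [ p ]} {E , [ q ]} E⊆D = lift p q (descend E⊆D λ X E⊆X X⊆D →
    -- Decidability turns the irrelevant proof into a usable one.
    dominating-⊆ G E⊆X (proj₁ (recompute (smallDominating? k G E) q)) ,
    ≤-trans (p⊆q⇒∣p∣≤∣q∣ X⊆D) (proj₂ (recompute (smallDominating? k G D) p)))

-- Dominating sets of complete bipartite graphs

DominatingSizes : ℕ → ℕ → ℕ → ℕ → Set
DominatingSizes m n a b = (1 ≤ a ⊎ b ≡ n) × (1 ≤ b ⊎ a ≡ m)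

-- If one part is missed entirely, a vertex of the other part has no neighbour in the set, so it
-- must itself belong to it.
dominating⇒sizes : (A : Subset m) (B : Subset n) →
  Graph.Dominating (K m n) (A ++ B) → DominatingSizes m n ∣ A ∣ ∣ B ∣
dominating⇒sizes {m} {n} A B dom = left , right
  where
  left : 1 ≤ ∣ A ∣ ⊎ ∣ B ∣ ≡ n
  left with nonempty? A
  ... | yes A≢∅ = inj₁ (nonempty⇒0<∣∣ A≢∅)
  ... | no  A≡∅ = inj₂ (full⇒∣∣≡n full)
    where
    full : ∀ j → j ∈ B
    full j with j ∈? B
    ... | yes j∈B = j∈B
    ... | no  j∉B with dom (inj₂ j) (j∉B ∘ Equivalence.from (∈-++ʳ {A = A}))
    ...   | inj₁ i , i∈A , _ = contradiction (i , Equivalence.from (∈-++ˡ {B = B}) i∈A) A≡∅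
  right : 1 ≤ ∣ B ∣ ⊎ ∣ A ∣ ≡ m
  right with nonempty? B
  ... | yes B≢∅ = inj₁ (nonempty⇒0<∣∣ B≢∅)
  ... | no  B≡∅ = inj₂ (full⇒∣∣≡n full)
    where
    full : ∀ i → i ∈ A
    full i with i ∈? A
    ... | yes i∈A = i∈A
    ... | no  i∉A with dom (inj₁ i) (i∉A ∘ Equivalence.from (∈-++ˡ {B = B}))
    ...   | inj₂ j , j∈B , _ = contradiction (j , Equivalence.from (∈-++ʳ {A = A}) j∈B) B≡∅

sizes⇒dominating : (A : Subset m) (B : Subset n) →
  DominatingSizes m n ∣ A ∣ ∣ B ∣ → Graph.Dominating (K m n) (A ++ B)
sizes⇒dominating A B (_ , inj₁ 1≤∣B∣) (inj₁ i) _ with 0<∣∣⇒nonempty B 1≤∣B∣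
... | j , j∈B = inj₂ j , Equivalence.to (∈-++ʳ {A = A}) j∈B , _
sizes⇒dominating A B (_ , inj₂ ∣A∣≡m) (inj₁ i) i∉ =
  contradiction (Equivalence.to (∈-++ˡ {B = B}) (subst (i ∈_) (sym (∣p∣≡n⇒p≡⊤ ∣A∣≡m)) ∈⊤)) i∉
sizes⇒dominating A B (inj₁ 1≤∣A∣ , _) (inj₂ j) _ with 0<∣∣⇒nonempty A 1≤∣A∣
... | i , i∈A = inj₁ i , Equivalence.to (∈-++ˡ {B = B}) i∈A , _
sizes⇒dominating A B (inj₂ ∣B∣≡n , _) (inj₂ j) j∉ =
  contradiction (Equivalence.to (∈-++ʳ {A = A}) (subst (j ∈_) (sym (∣p∣≡n⇒p≡⊤ ∣B∣≡n)) ∈⊤)) j∉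

≤γ : (∀ a b → DominatingSizes m n a b → c ≤ a + b) → c ≤ γ (K m n)
≤γ {m} {n} {c} bound = subst (c ≤_) (trans (sym (∣++∣ A B)) (cong ∣_∣ (take++drop≡id m D)))
  (bound ∣ A ∣ ∣ B ∣ (dominating⇒sizes A B
    (subst (Graph.Dominating (K m n)) (sym (take++drop≡id m D)) (minimumDominatingSet-dominating (K m n)))))
  where
  D = minimumDominatingSet (K m n)
  A = take m D
  B = drop m D

pred≢ : 1 ≤ n → pred n ≢ n
pred≢ (s≤s _) ()

module _ (m n k : ℕ) where
  open Graph (𝒟 k (K m n))

  Sizes : ℕ → ℕ → Set
  Sizes a b = DominatingSizes m n a b × a + b ≤ k

  sizes? : ∀ a b → Dec (Sizes a b)
  sizes? a b = (((1 ≤? a) ⊎-dec (b ≟ℕ n)) ×-dec ((1 ≤? b) ⊎-dec (a ≟ℕ m))) ×-dec (a + b ≤? k)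

  -- The terms count removals and additions in the part of size `m`, then removals and additions in
  -- the part of size `n`.
  sizeDegree : ℕ → ℕ → ℕ
  sizeDegree a b = (a when sizes? (pred a) b + (m ∸ a) when sizes? (suc a) b)
                 + (b when sizes? a (pred b) + (n ∸ b) when sizes? a (suc b))

  small⇔sizes : (A : Subset m) (B : Subset n) → SmallDominating k (K m n) (A ++ B) ⇔ Sizes ∣ A ∣ ∣ B ∣
  small⇔sizes A B = mk⇔
    (λ (dom , ≤k) → dominating⇒sizes A B dom , subst (_≤ k) (∣++∣ A B) ≤k)
    (λ (dom , ≤k) → sizes⇒dominating A B dom , subst (_≤ k) (sym (∣++∣ A B)) ≤k)

  count-small : (A : Subset m) (B : Subset n) →
    length (filter (smallDominating? k (K m n)) (flips (A ++ B))) ≡ sizeDegree ∣ A ∣ ∣ B ∣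
  count-small A B = begin
    length (filter small? (flips (A ++ B)))
      ≡⟨ cong (length ∘ filter small?) (flips-++ A B) ⟩
    length (filter small? (map (_++ B) (flips A) List.++ map (A ++_) (flips B)))
      ≡⟨ cong length (filter-++ small? (map (_++ B) (flips A)) _) ⟩
    length (filter small? (map (_++ B) (flips A)) List.++ filter small? (map (A ++_) (flips B)))
      ≡⟨ length-++ (filter small? (map (_++ B) (flips A))) ⟩
    length (filter small? (map (_++ B) (flips A))) + length (filter small? (map (A ++_) (flips B)))
      ≡⟨ cong₂ _+_ countˡ countʳ ⟩
    sizeDegree ∣ A ∣ ∣ B ∣ ∎
    where
    open ≡-Reasoning
    ∣A∣ = ∣ A ∣
    ∣B∣ = ∣ B ∣
    small? = smallDominating? k (K m n)
    countˡ : length (filter small? (map (_++ B) (flips A)))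
      ≡ ∣A∣ when sizes? (pred ∣A∣) ∣B∣ + (m ∸ ∣A∣) when sizes? (suc ∣A∣) ∣B∣
    countˡ = begin
      length (filter small? (map (_++ B) (flips A)))
        ≡⟨ length-filter-map small? (_++ B) (flips A) ⟩
      length (filter (small? ∘ (_++ B)) (flips A))
        ≡⟨ cong length (filter-≐ (small? ∘ (_++ B)) ((λ a → sizes? a ∣B∣) ∘ ∣_∣)
             ((λ {E} → Equivalence.to (small⇔sizes E B)) , (λ {E} → Equivalence.from (small⇔sizes E B))) (flips A)) ⟩
      length (filter ((λ a → sizes? a ∣B∣) ∘ ∣_∣) (flips A))
        ≡⟨ count-flips (λ a → sizes? a ∣B∣) A ⟩
      ∣A∣ when sizes? (pred ∣A∣) ∣B∣ + ∣ ∁ A ∣ when sizes? (suc ∣A∣) ∣B∣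
        ≡⟨ cong (λ x → ∣A∣ when sizes? (pred ∣A∣) ∣B∣ + x when sizes? (suc ∣A∣) ∣B∣) (∣∁p∣≡n∸∣p∣ A) ⟩
      ∣A∣ when sizes? (pred ∣A∣) ∣B∣ + (m ∸ ∣A∣) when sizes? (suc ∣A∣) ∣B∣ ∎
    countʳ : length (filter small? (map (A ++_) (flips B)))
      ≡ ∣B∣ when sizes? ∣A∣ (pred ∣B∣) + (n ∸ ∣B∣) when sizes? ∣A∣ (suc ∣B∣)
    countʳ = begin
      length (filter small? (map (A ++_) (flips B)))
        ≡⟨ length-filter-map small? (A ++_) (flips B) ⟩
      length (filter (small? ∘ (A ++_)) (flips B))
        ≡⟨ cong length (filter-≐ (small? ∘ (A ++_)) (sizes? ∣A∣ ∘ ∣_∣)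
             ((λ {E} → Equivalence.to (small⇔sizes A E)) , (λ {E} → Equivalence.from (small⇔sizes A E))) (flips B)) ⟩
      length (filter (sizes? ∣A∣ ∘ ∣_∣) (flips B))
        ≡⟨ count-flips (sizes? ∣A∣) B ⟩
      ∣B∣ when sizes? ∣A∣ (pred ∣B∣) + ∣ ∁ B ∣ when sizes? ∣A∣ (suc ∣B∣)
        ≡⟨ cong (λ x → ∣B∣ when sizes? ∣A∣ (pred ∣B∣) + x when sizes? ∣A∣ (suc ∣B∣)) (∣∁p∣≡n∸∣p∣ B) ⟩
      ∣B∣ when sizes? ∣A∣ (pred ∣B∣) + (n ∸ ∣B∣) when sizes? ∣A∣ (suc ∣B∣) ∎

  pair : (A : Subset m) (B : Subset n) → .(Sizes ∣ A ∣ ∣ B ∣) → Vertex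
  pair A B s = A ++ B , [ Equivalence.from (small⇔sizes A B) s ]

  degree-pair : ∀ A B .(s : Sizes ∣ A ∣ ∣ B ∣) → degree (pair A B s) ≡ sizeDegree ∣ A ∣ ∣ B ∣
  degree-pair A B s = trans (degree-𝒟 k (K m n) (pair A B s)) (count-small A B)

  -- A view that splits a vertex into its two parts and makes the size conditions relevant again.
  data IsPair : Vertex → Set where
    isPair : ∀ A B (s : Sizes ∣ A ∣ ∣ B ∣) → IsPair (pair A B s)

  vertex-isPair : ∀ v → IsPair v
  vertex-isPair (D , [ p ]) with take m D | drop m D | take++drop≡id m D
  ... | A | B | refl = isPair A B
    (Equivalence.to (small⇔sizes A B) (recompute (smallDominating? k (K m n) (A ++ B)) p))

  -- Every admissible pair of sizes is realised by an actual vertex, so the parity conditions become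
  -- purely numerical.
  even-sizeDegree : (∀ v → 2 ∣ degree v) → a ≤ m → b ≤ n → Sizes a b → 2 ∣ sizeDegree a b
  even-sizeDegree even a≤m b≤n s with ∃-size a≤m | ∃-size b≤n
  ... | A , refl | B , refl = subst (2 ∣_) (degree-pair A B s) (even (pair A B s))

  even-degree : (∀ a b → a ≤ m → b ≤ n → Sizes a b → 2 ∣ sizeDegree a b) → ∀ v → 2 ∣ degree v
  even-degree even v with vertex-isPair v
  ... | isPair A B s = subst (2 ∣_) (sym (degree-pair A B s)) (even _ _ (∣p∣≤n A) (∣p∣≤n B) s)

  mixed : 1 ≤ a → 1 ≤ b → a + b ≤ k → Sizes a b
  mixed 1≤a 1≤b a+b≤k = (inj₁ 1≤a , inj₁ 1≤b) , a+b≤k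

  -- Such a set is exactly the second part: no vertex can be removed without losing domination, that
  -- part has none left to add, and a vertex of the first part would give `suc n > k` elements.
  sizeDegree-0ˡ : 1 ≤ n → k ≤ n → Sizes 0 b → sizeDegree 0 b ≡ 0
  sizeDegree-0ˡ {b} 1≤n k≤n ((inj₂ refl , _) , _) = cong₂ _+_
    (cong₂ _+_ (0-when (sizes? 0 n)) (when-no (sizes? 1 n) (λ (_ , n<k) → <⇒≱ n<k k≤n)))
    (cong₂ _+_ (when-no (sizes? 0 (pred n)) λ { ((inj₂ eq , _) , _) → pred≢ 1≤n eq })
      (trans (cong (λ x → x when sizes? 0 (suc n)) (n∸n≡0 n)) (0-when (sizes? 0 (suc n)))))

  sizeDegree-0ʳ : 1 ≤ m → k ≤ m → Sizes a 0 → sizeDegree a 0 ≡ 0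
  sizeDegree-0ʳ {a} 1≤m k≤m ((_ , inj₂ refl) , _) = cong₂ _+_
    (cong₂ _+_ (when-no (sizes? (pred m) 0) λ { ((_ , inj₂ eq) , _) → pred≢ 1≤m eq })
      (trans (cong (λ x → x when sizes? (suc m) 0) (n∸n≡0 m)) (0-when (sizes? (suc m) 0))))
    (cong₂ _+_ (0-when (sizes? m 0)) (when-no (sizes? m 1) (λ (_ , m<k) → <⇒≱ (subst (_≤ k) (+-comm m 1) m<k) k≤m)))

  -- Shrink to `i` and `j`, exchange `j` for `y` through `v₂`, then `i` for `x` through `v₄`. The
  -- exchanges pass through sets of at most three elements, whence `3 ≤ k`.
  mixed-connected : 3 ≤ k → ∀ {A B i j x y} → i ∈ A → j ∈ B → (s : Sizes ∣ A ∣ ∣ B ∣) (t : Sizes ∣ ⁅ x ⁆ ∣ ∣ ⁅ y ⁆ ∣) →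
    Star _~_ (pair A B s) (pair ⁅ x ⁆ ⁅ y ⁆ t)
  mixed-connected 3≤k {A} {B} {i} {j} {x} {y} i∈A j∈B s t =
    down {w = pair ⁅ i ⁆ ⁅ j ⁆ (singletons i j)} (++-mono-⊆ (⁅⁆⊆ i∈A) (⁅⁆⊆ j∈B)) ◅◅
    up   {w = v₂} (++-mono-⊆ {A = ⁅ i ⁆} id (p⊆p∪q ⁅ y ⁆)) ◅◅
    down {w = pair ⁅ i ⁆ ⁅ y ⁆ (singletons i y)} (++-mono-⊆ {A = ⁅ i ⁆} id (q⊆p∪q ⁅ j ⁆ ⁅ y ⁆)) ◅◅
    up   {w = v₄} (++-mono-⊆ {B = ⁅ y ⁆} (p⊆p∪q ⁅ x ⁆) id) ◅◅
    down (++-mono-⊆ {B = ⁅ y ⁆} (q⊆p∪q ⁅ i ⁆ ⁅ x ⁆) id)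
    where
    down : ∀ {v w : Vertex} → value w ⊆ value v → Star _~_ v w
    down = ⊇⇒connected k (K m n)
    up : ∀ {v w : Vertex} → value v ⊆ value w → Star _~_ v w
    up v⊆w = reverse ⟶-sym (down v⊆w)
    ⁅⁆⊆ : ∀ {n} {x : Fin n} {D} → x ∈ D → ⁅ x ⁆ ⊆ D
    ⁅⁆⊆ {x = x} x∈D y∈ = subst (_∈ _) (sym (x∈⁅y⁆⇒x≡y x y∈)) x∈D
    -- Only an inequality, since the two elements may coincide.
    ∣⁅⁆∪⁅⁆∣≤2 : ∀ {n} (x y : Fin n) → ∣ ⁅ x ⁆ ∪ ⁅ y ⁆ ∣ ≤ 2
    ∣⁅⁆∪⁅⁆∣≤2 x y = ≤-trans (∣∪∣≤ ⁅ x ⁆ ⁅ y ⁆) (≤-reflexive (cong₂ _+_ (∣⁅x⁆∣≡1 x) (∣⁅x⁆∣≡1 y)))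
    1≤∣⁅⁆∣ : ∀ {n} (x : Fin n) → 1 ≤ ∣ ⁅ x ⁆ ∣
    1≤∣⁅⁆∣ x = ≤-reflexive (sym (∣⁅x⁆∣≡1 x))
    singletons : ∀ i j → Sizes ∣ ⁅ i ⁆ ∣ ∣ ⁅ j ⁆ ∣
    singletons i j = mixed (1≤∣⁅⁆∣ i) (1≤∣⁅⁆∣ j)
      (≤-trans (≤-reflexive (cong₂ _+_ (∣⁅x⁆∣≡1 i) (∣⁅x⁆∣≡1 j))) (≤-trans (n≤1+n 2) 3≤k))
    v₂ v₄ : Vertex
    v₂ = pair ⁅ i ⁆ (⁅ j ⁆ ∪ ⁅ y ⁆) (mixed (1≤∣⁅⁆∣ i) (≤-trans (1≤∣⁅⁆∣ j) (∣p∣≤∣p∪q∣ ⁅ j ⁆ ⁅ y ⁆))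
      (≤-trans (+-mono-≤ (≤-reflexive (∣⁅x⁆∣≡1 i)) (∣⁅⁆∪⁅⁆∣≤2 j y)) 3≤k))
    v₄ = pair (⁅ i ⁆ ∪ ⁅ x ⁆) ⁅ y ⁆ (mixed (≤-trans (1≤∣⁅⁆∣ i) (∣p∣≤∣p∪q∣ ⁅ i ⁆ ⁅ x ⁆)) (1≤∣⁅⁆∣ y)
      (≤-trans (+-mono-≤ (∣⁅⁆∪⁅⁆∣≤2 i x) (≤-reflexive (∣⁅x⁆∣≡1 y))) 3≤k))

-- Parity of natural numbers

even⊎odd : ∀ n → (2 ∣ n) ⊎ (2 ∣ suc n)
even⊎odd zero    = inj₁ (2 ∣0)
even⊎odd (suc n) with even⊎odd n
... | inj₁ 2∣n   = inj₂ (∣m∣n⇒∣m+n ∣-refl 2∣n)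
... | inj₂ 2∣1+n = inj₁ 2∣1+n

¬consecutive-even : 2 ∣ n → ¬ (2 ∣ suc n)
¬consecutive-even {n} 2∣n 2∣1+n with () ← ∣1⇒≡1 (∣m+n∣m⇒∣n (subst (2 ∣_) (+-comm 1 n) 2∣1+n) 2∣n)

even-sum⇒≡-mod2 : ∀ m n → 2 ∣ m + n → m % 2 ≡ n % 2
even-sum⇒≡-mod2 zero          n             2∣ = sym (n∣m⇒m%n≡0 n 2 2∣)
even-sum⇒≡-mod2 (suc zero)    zero          2∣ with () ← ∣1⇒≡1 2∣
even-sum⇒≡-mod2 (suc zero)    (suc zero)    2∣ = refl
even-sum⇒≡-mod2 (suc zero)    (suc (suc n)) 2∣ = even-sum⇒≡-mod2 1 n (∣m+n∣m⇒∣n 2∣ ∣-refl)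
even-sum⇒≡-mod2 (suc (suc m)) n             2∣ = even-sum⇒≡-mod2 m n (∣m+n∣m⇒∣n 2∣ ∣-refl)

≡-mod2⇒even-sum : ∀ m n → m % 2 ≡ n % 2 → 2 ∣ m + n
≡-mod2⇒even-sum zero          n             eq = m%n≡0⇒n∣m n 2 (sym eq)
≡-mod2⇒even-sum (suc zero)    (suc zero)    eq = ∣-refl
≡-mod2⇒even-sum (suc zero)    (suc (suc n)) eq = ∣m∣n⇒∣m+n ∣-refl (≡-mod2⇒even-sum 1 n eq)
≡-mod2⇒even-sum (suc (suc m)) n             eq = ∣m∣n⇒∣m+n ∣-refl (≡-mod2⇒even-sum m n eq)

-- Stars: the case `m = 1`

module StarGraph (n k : ℕ) (2≤k : 2 ≤ k) (k≤n : k ≤ n) where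

  1≤n : 1 ≤ n
  1≤n = ≤-trans (n≤1+n 1) (≤-trans 2≤k k≤n)

  center : ∀ {b} → 1 + b ≤ k → Sizes 1 n k 1 b
  center 1+b≤k = (inj₁ ≤-refl , inj₂ refl) , 1+b≤k

  -- Without the centre all `n` leaves would be needed, but `b < k ≤ n`.
  center-irremovable : ∀ {b} → 1 + b ≤ k → ¬ Sizes 1 n k 0 b
  center-irremovable 1+b≤k ((inj₂ refl , _) , _) = <⇒≱ 1+b≤k k≤n

  -- Every leaf can be removed or added, whichever applies; the centre is fixed.
  sizeDegree-< : ∀ b → 1 + b < k → sizeDegree 1 n k 1 b ≡ n
  sizeDegree-< b 1+b<k = trans (cong₂ _+_
    (cong₂ _+_ (when-no (sizes? 1 n k 0 b) (center-irremovable (<⇒≤ 1+b<k))) (0-when (sizes? 1 n k 2 b)))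
    (cong₂ _+_ (when-yes (sizes? 1 n k 1 (pred b)) (center (≤-trans (s≤s pred[n]≤n) (<⇒≤ 1+b<k))))
               (when-yes (sizes? 1 n k 1 (suc b)) (center 1+b<k))))
    (m+[n∸m]≡n (≤-trans (≤-trans (n≤1+n b) (<⇒≤ 1+b<k)) k≤n))

  -- At the maximal size, only the removals of leaves remain.
  sizeDegree-≡ : ∀ b → 1 + b ≡ k → sizeDegree 1 n k 1 b ≡ b
  sizeDegree-≡ b refl = trans (cong₂ _+_
    (cong₂ _+_ (when-no (sizes? 1 n k 0 b) (center-irremovable ≤-refl)) (0-when (sizes? 1 n k 2 b)))
    (cong₂ _+_ (when-yes (sizes? 1 n k 1 (pred b)) (center (s≤s pred[n]≤n)))
               (when-no (sizes? 1 n k 1 (suc b)) (λ (_ , k<k) → <-irrefl refl k<k))))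
    (+-identityʳ b)

  eulerian⇒parities : Eulerian (𝒟 k (K 1 n)) → 2 ∣ n × ¬ (2 ∣ k)
  eulerian⇒parities (even , _) = 2∣n , odd 2≤k k≤n refl
    where
    2∣n : 2 ∣ n
    2∣n = subst (2 ∣_) (sizeDegree-< 0 2≤k)
      (even-sizeDegree 1 n k even ≤-refl z≤n (center (<⇒≤ 2≤k)))
    -- The module parameter `k` cannot be matched on, so a copy `l` is. The witness is the centre
    -- with `k − 1` leaves.
    odd : ∀ {l} → 2 ≤ l → l ≤ n → l ≡ k → ¬ 2 ∣ l
    odd {suc l} _ 1+l≤n 1+l≡k = ¬consecutive-even (subst (2 ∣_) (sizeDegree-≡ l 1+l≡k)
      (even-sizeDegree 1 n k even ≤-refl (≤-trans (n≤1+n l) 1+l≤n) (center (≤-reflexive 1+l≡k))))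

  parities⇒eulerian : 2 ∣ n → ¬ (2 ∣ k) → Eulerian (𝒟 k (K 1 n))
  parities⇒eulerian 2∣n 2∤k =
    even-degree 1 n k even , hub⇒atMostOneNonTrivialComponent (𝒟 k (K 1 n)) hub toHub
    where
    open Graph (𝒟 k (K 1 n)) using (Vertex; _~_)

    even : ∀ a b → a ≤ 1 → b ≤ n → Sizes 1 n k a b → 2 ∣ sizeDegree 1 n k a b
    even zero          b _ _ s = subst (2 ∣_) (sym (sizeDegree-0ˡ 1 n k 1≤n k≤n s)) (2 ∣0)
    even (suc zero)    b _ _ (_ , 1+b≤k) with m≤n⇒m<n∨m≡n 1+b≤k | even⊎odd b
    ... | inj₁ 1+b<k | _          = subst (2 ∣_) (sym (sizeDegree-< b 1+b<k)) 2∣n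
    ... | inj₂ 1+b≡k | inj₁ 2∣b   = subst (2 ∣_) (sym (sizeDegree-≡ b 1+b≡k)) 2∣b
    ... | inj₂ 1+b≡k | inj₂ 2∣1+b = contradiction (subst (2 ∣_) 1+b≡k 2∣1+b) 2∤k
    even (suc (suc _)) b (s≤s ())

    hub : Vertex
    hub = pair 1 n k ⁅ zero ⁆ Subset.⊥ (center (≤-trans (s≤s (≤-reflexive (∣⊥∣≡0 n))) (<⇒≤ 2≤k)))

    toHub : ∀ u w → u ~ w → Star _~_ u hub
    toHub u w u~w with vertex-isPair 1 n k u
    -- The hub is the centre alone, hence a subset of every set containing the centre.
    ... | isPair (inside  ∷ []) B s = ⊇⇒connected k (K 1 n) (s⊆s ⊥⊆)
    ... | isPair (outside ∷ []) B s = contradiction u~w (degree≡0⇒isolated (𝒟 k (K 1 n)) u w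
      (trans (degree-pair 1 n k (outside ∷ []) B s) (sizeDegree-0ˡ 1 n k 1≤n k≤n s)))

-- Both parts of size at least 2: necessary conditions

module _ (m n k : ℕ) (2≤m : 2 ≤ m) (2≤n : 2 ≤ n) (3≤k : 3 ≤ k) where

  -- No removal is possible, because the one vertex left would have to be its whole part. All
  -- additions are allowed, as `3 ≤ k`.
  sizeDegree-1-1 : sizeDegree m n k 1 1 ≡ (m ∸ 1) + (n ∸ 1)
  sizeDegree-1-1 = cong₂ _+_
    (cong₂ _+_ (when-no (sizes? m n k 0 1) λ { ((inj₂ refl , _) , _) → <-irrefl refl 2≤n })
               (when-yes (sizes? m n k 2 1) (mixed m n k (s≤s z≤n) (s≤s z≤n) 3≤k)))
    (cong₂ _+_ (when-no (sizes? m n k 1 0) λ { ((_ , inj₂ refl) , _) → <-irrefl refl 2≤m })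
               (when-yes (sizes? m n k 1 2) (mixed m n k (s≤s z≤n) (s≤s z≤n) 3≤k)))

  -- Now two removals, down to `(1 , 1)`, are possible. By `3 ≤ n` the two vertices are not their
  -- whole part, so the single one opposite cannot go.
  sizeDegree-1-2 : 3 ≤ n → 4 ≤ k → sizeDegree m n k 1 2 ≡ (m ∸ 1) + (2 + (n ∸ 2))
  sizeDegree-1-2 3≤n 4≤k = cong₂ _+_
    (cong₂ _+_ (when-no (sizes? m n k 0 2) λ { ((inj₂ refl , _) , _) → <-irrefl refl 3≤n })
               (when-yes (sizes? m n k 2 2) (mixed m n k (s≤s z≤n) (s≤s z≤n) 4≤k)))
    (cong₂ _+_ (when-yes (sizes? m n k 1 1) (mixed m n k (s≤s z≤n) (s≤s z≤n) (<⇒≤ 3≤k)))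
               (when-yes (sizes? m n k 1 3) (mixed m n k (s≤s z≤n) (s≤s z≤n) 4≤k)))

  eulerian⇒≡-mod2 : Eulerian (𝒟 k (K m n)) → m % 2 ≡ n % 2
  eulerian⇒≡-mod2 (even , _) = sameParity 2≤m 2≤n (subst (2 ∣_) sizeDegree-1-1
    (even-sizeDegree m n k even (<⇒≤ 2≤m) (<⇒≤ 2≤n) (mixed m n k ≤-refl ≤-refl (<⇒≤ 3≤k))))
    where
    sameParity : ∀ {m n} → 2 ≤ m → 2 ≤ n → 2 ∣ (m ∸ 1) + (n ∸ 1) → m % 2 ≡ n % 2
    sameParity {suc m} {suc n} _ _ 2∣ = even-sum⇒≡-mod2 (suc m) (suc n)
      (subst (2 ∣_) (cong suc (sym (+-suc m n))) (∣m∣n⇒∣m+n ∣-refl 2∣))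

  -- For `k ≥ 4` the degrees at `(1 , 1)` and `(1 , 2)` are consecutive numbers.
  eulerian⇒k≤3 : 3 ≤ n → Eulerian (𝒟 k (K m n)) → k ≤ 3
  eulerian⇒k≤3 3≤n (even , _) = ≮⇒≥ λ 4≤k → ¬consecutive-even
    (subst (2 ∣_) sizeDegree-1-1
      (even-sizeDegree m n k even (<⇒≤ 2≤m) (<⇒≤ 2≤n) (mixed m n k ≤-refl ≤-refl (<⇒≤ 3≤k))))
    (subst (2 ∣_) (trans (sizeDegree-1-2 3≤n 4≤k) (successor 2≤n))
      (even-sizeDegree m n k even (<⇒≤ 2≤m) 2≤n (mixed m n k ≤-refl (s≤s z≤n) 3≤k)))
    where
    successor : ∀ {n} → 2 ≤ n → (m ∸ 1) + (2 + (n ∸ 2)) ≡ suc ((m ∸ 1) + (n ∸ 1))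
    successor {suc (suc n)} _ = +-suc (m ∸ 1) (suc n)
    successor {suc zero} (s≤s ())

-- At `(2 , 1)` the first part is complete, so each of the three vertices can be removed, and the
-- bound 3 forbids additions.
𝒟₃[K2n]-not-eulerian : 2 ≤ n → ¬ Eulerian (𝒟 3 (K 2 n))
𝒟₃[K2n]-not-eulerian {n} 2≤n (even , _) = ¬consecutive-even ∣-refl (subst (2 ∣_) sizeDegree-2-1
    (even-sizeDegree 2 n 3 even ≤-refl (<⇒≤ 2≤n) (mixed 2 n 3 (s≤s z≤n) ≤-refl ≤-refl)))
  where
  sizeDegree-2-1 : sizeDegree 2 n 3 2 1 ≡ 3
  sizeDegree-2-1 = cong₂ _+_
    (cong₂ _+_ (when-yes {x = 2} (sizes? 2 n 3 1 1) (mixed 2 n 3 ≤-refl ≤-refl (n≤1+n 2))) (0-when (sizes? 2 n 3 3 1)))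
    (cong₂ _+_ (when-yes {x = 1} (sizes? 2 n 3 2 0) ((inj₁ (s≤s z≤n) , inj₂ refl) , n≤1+n 2))
               (when-no {x = n ∸ 1} (sizes? 2 n 3 2 2) λ { (_ , s≤s (s≤s (s≤s ()))) }))

-- Both parts of size at least 3 and `k = 3`: sufficiency

𝒟₃-eulerian : 3 ≤ m → 3 ≤ n → m % 2 ≡ n % 2 → Eulerian (𝒟 3 (K m n))
𝒟₃-eulerian {m@(suc m′)} {n@(suc n′)} 3≤m 3≤n m≡n =
  even-degree m n 3 even , hub⇒atMostOneNonTrivialComponent (𝒟 3 (K m n)) hub toHub
  where
  open Graph (𝒟 3 (K m n)) using (Vertex; _~_)

  even : ∀ a b → a ≤ m → b ≤ n → Sizes m n 3 a b → 2 ∣ sizeDegree m n 3 a b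
  even 0 b _ _ s = subst (2 ∣_) (sym (sizeDegree-0ˡ m n 3 (s≤s z≤n) 3≤n s)) (2 ∣0)
  even a@(suc _) 0 _ _ s = subst (2 ∣_) (sym (sizeDegree-0ʳ m n 3 (s≤s z≤n) 3≤m s)) (2 ∣0)
  -- The degree is `m′ + n′`, which is 2 less than the even number `m + n`.
  even 1 1 _ _ _ = subst (2 ∣_) (sym (sizeDegree-1-1 m n 3 (<⇒≤ 3≤m) (<⇒≤ 3≤n) ≤-refl))
    (∣m+n∣m⇒∣n {m = 2} (subst (2 ∣_) (cong suc (+-suc m′ n′)) (≡-mod2⇒even-sum m n m≡n)) ∣-refl)
  -- The degree is 2: additions exceed the bound, and dropping the single vertex fails since two
  -- vertices are not the whole part. The case `(1 , 2)` is symmetric.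
  even 2 1 _ _ _ = subst (2 ∣_) (sym (cong₂ _+_
    (cong₂ _+_ (when-yes {x = 2} (sizes? m n 3 1 1) (mixed m n 3 ≤-refl ≤-refl (n≤1+n 2)))
               (when-no {x = m ∸ 2} (sizes? m n 3 3 1) λ { (_ , s≤s (s≤s (s≤s ()))) }))
    (cong₂ _+_ (when-no {x = 1} (sizes? m n 3 2 0) λ { ((_ , inj₂ refl) , _) → <-irrefl refl 3≤m })
               (when-no {x = n ∸ 1} (sizes? m n 3 2 2) λ { (_ , s≤s (s≤s (s≤s ()))) })))) ∣-refl
  even 1 2 _ _ _ = subst (2 ∣_) (sym (cong₂ _+_
    (cong₂ _+_ (when-no {x = 1} (sizes? m n 3 0 2) λ { ((inj₂ refl , _) , _) → <-irrefl refl 3≤n })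
               (when-no {x = m ∸ 1} (sizes? m n 3 2 2) λ { (_ , s≤s (s≤s (s≤s ()))) }))
    (cong₂ _+_ (when-yes {x = 2} (sizes? m n 3 1 1) (mixed m n 3 ≤-refl ≤-refl (n≤1+n 2)))
               (when-no {x = n ∸ 2} (sizes? m n 3 1 3) λ { (_ , s≤s (s≤s (s≤s ()))) })))) ∣-refl
  even 1 (suc (suc (suc _))) _ _ (_ , s≤s (s≤s (s≤s ())))
  even 2 (suc (suc _)) _ _ (_ , s≤s (s≤s (s≤s ())))
  even (suc (suc (suc a))) (suc b) _ _ (_ , s≤s (s≤s (s≤s ≤0)))
    with () ← subst (_≤ 0) (+-suc a b) ≤0

  sizes-hub : Sizes m n 3 ∣ ⁅ zero {n = m′} ⁆ ∣ ∣ ⁅ zero {n = n′} ⁆ ∣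
  sizes-hub = mixed m n 3 (s≤s z≤n) (s≤s z≤n)
    (≤-trans (≤-reflexive (cong₂ _+_ (∣⁅x⁆∣≡1 {m} zero) (∣⁅x⁆∣≡1 {n} zero))) (n≤1+n 2))

  hub : Vertex
  hub = pair m n 3 ⁅ zero ⁆ ⁅ zero ⁆ sizes-hub

  toHub : ∀ u w → u ~ w → Star _~_ u hub
  toHub u w u~w with vertex-isPair m n 3 u
  ... | isPair A B s with nonempty? A | nonempty? B
  ...   | yes (i , i∈A) | yes (j , j∈B) = mixed-connected m n 3 ≤-refl {x = zero} {zero} i∈A j∈B s sizes-hub
  ...   | no A≡∅ | _ = contradiction u~w (degree≡0⇒isolated (𝒟 3 (K m n)) u w
    (trans (degree-pair m n 3 A B s) (deg0 (empty⇒∣∣≡0 A≡∅) s)))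
    where
    -- Sizes become variables here, so that the equation can be matched with `refl`.
    deg0 : ∀ {a b} → a ≡ 0 → Sizes m n 3 a b → sizeDegree m n 3 a b ≡ 0
    deg0 refl = sizeDegree-0ˡ m n 3 (s≤s z≤n) 3≤n
  ...   | yes _ | no B≡∅ = contradiction u~w (degree≡0⇒isolated (𝒟 3 (K m n)) u w
    (trans (degree-pair m n 3 A B s) (deg0 (empty⇒∣∣≡0 B≡∅) s)))
    where
    deg0 : ∀ {a b} → b ≡ 0 → Sizes m n 3 a b → sizeDegree m n 3 a b ≡ 0
    deg0 refl = sizeDegree-0ʳ m n 3 (s≤s z≤n) 3≤m

-- Lower bounds on the domination number, and the case distinction on `m`

1≤γ : 1 ≤ m → 1 ≤ n → 1 ≤ γ (K m n)
1≤γ {m} {n} 1≤m 1≤n = ≤γ {m} {n} λ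
  { (suc a) b       _                    → s≤s z≤n
  ; zero    (suc b) _                    → s≤s z≤n
  ; zero    zero    (inj₂ refl , _) → 1≤n
  }

-- A dominating set meets both parts or contains one of them entirely.
2≤γ : 2 ≤ m → 2 ≤ n → 2 ≤ γ (K m n)
2≤γ {m} {n} 2≤m 2≤n = ≤γ {m} {n} λ
  { (suc a)       (suc b) _                → s≤s (≤-trans (s≤s z≤n) (m≤n+m (suc b) a))
  ; zero          b       (inj₂ refl , _)  → 2≤n
  ; a             zero    (_ , inj₂ refl)  → ≤-trans 2≤m (m≤m+n _ 0)
  }

theorem9 : (m n k : ℕ) → 1 ≤ m → 1 ≤ n → m ≤ n → γ (K m n) < k → k < m + n →
    Eulerian (𝒟 k (K m n)) ⇔
    ((m ≡ 1 × 2 ∣ n × ¬ (2 ∣ k)) ⊎ (3 ≤ m × m % 2 ≡ n % 2 × k ≡ 3))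
theorem9 1 n k 1≤m 1≤n m≤n γ<k k<1+n = mk⇔
  (λ eulerian → inj₁ (refl , eulerian⇒parities eulerian))
  (λ { (inj₁ (_ , 2∣n , 2∤k)) → parities⇒eulerian 2∣n 2∤k ; (inj₂ (s≤s () , _)) })
  -- From `1 ≤ γ < k` comes `2 ≤ k`, and `k < 1 + n` is `k ≤ n`.
  where open StarGraph n k (≤-trans (s≤s (1≤γ {1} {n} 1≤m 1≤n)) γ<k) (s≤s⁻¹ k<1+n)
theorem9 m@(suc (suc m′)) n k 1≤m 1≤n m≤n γ<k k<m+n = mk⇔ forward
  λ { (inj₂ (3≤m , m≡n , refl)) → 𝒟₃-eulerian 3≤m (≤-trans 3≤m m≤n) m≡n }
  where
  2≤m : 2 ≤ m
  2≤m = s≤s (s≤s z≤n)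
  2≤n = ≤-trans 2≤m m≤n
  3≤k = ≤-trans (s≤s (2≤γ {m} {n} 2≤m 2≤n)) γ<k

  k≡3 : Eulerian (𝒟 k (K m n)) → k ≡ 3
  k≡3 eulerian with k ≤? 3
  ... | yes k≤3 = ≤-antisym k≤3 3≤k
  ... | no  k≰3 = contradiction (eulerian⇒k≤3 m n k 2≤m 2≤n 3≤k 3≤n eulerian) k≰3
    where
    -- m = n = 2 would give k < 4.
    3≤n : 3 ≤ n
    3≤n = ≮⇒≥ λ n<3 → k≰3 (s≤s⁻¹ (≤-trans k<m+n (+-mono-≤ (≤-trans m≤n (s≤s⁻¹ n<3)) (s≤s⁻¹ n<3))))

  2≢m : Eulerian (𝒟 k (K m n)) → 2 ≢ m
  2≢m eulerian 2≡m = 𝒟₃[K2n]-not-eulerian 2≤n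
    (subst₂ (λ m k → Eulerian (𝒟 k (K m n))) (sym 2≡m) (k≡3 eulerian) eulerian)

  forward : Eulerian (𝒟 k (K m n)) → (m ≡ 1 × 2 ∣ n × ¬ (2 ∣ k)) ⊎ (3 ≤ m × m % 2 ≡ n % 2 × k ≡ 3)
  forward eulerian = inj₂
    (≤∧≢⇒< 2≤m (2≢m eulerian) , eulerian⇒≡-mod2 m n k 2≤m 2≤n 3≤k eulerian , k≡3 eulerian)
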